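{- Let $c,k,m$ be positive integers. If $k\ge 1+\binom{c}{2}$ and $m\ge 3\,c!/2$, then $f^*(M_{k,m})>c$.
   Context: A digraph $D$ is finite with nonempty vertex set $V(D)$, and is identified with a relation $D\subseteq V(D)\times V(D)$ (its set of edges; loops are allowed). Its adjacency matrix has entry $1$ in position $(u,v)$ if $uv$ is an edge and $0$ otherwise. $\overline{D}=(V(D)\times V(D))\setminus D$ is its complement. A digraph is a Ferrers digraph if its successor sets $\{u: vu\in E\}$, over all vertices $v$, are linearly ordered by inclusion; equivalently, its adjacency matrix has no $2\times 2$ permutation submatrix (two rows and two columns, not necessarily consecutive). $f^*(D)$ is the minimum number of pairwise disjoint Ferrers digraphs on $V(D)$ (as edge sets) whose union is $\overline{D}$. $M_{k,m}$ is the digraph on $km$ vertices whose adjacency matrix is the $km\times km$ matrix consisting of $k$ rows and $k$ columns of $m\times m$ blocks, in which the diagonal blocks are identity matrices, all blocks below the diagonal consist entirely of $0$'s, and all blocks above the diagonal consist entirely of $1$'s. -}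

module Defs where

open import Data.Bool using (Bool; true; false)
open import Data.Fin using (Fin; quotient; remainder)
open import Data.Fin.Properties using (_≟_; <-cmp; all?; any?)
open import Data.Fin.Subset using (Subset; _∈_; _⊆_; ∁; ⊥)
open import Data.Fin.Subset.Properties using (_∈?_; _⊆?_; ∉⊥; ⊥⊆; ⊆-refl)
open import Data.Nat using (ℕ; zero; suc; _*_; _≤_; z≤n; s≤s)
open import Data.Product using (∃; _×_; _,_; proj₁; proj₂)
open import Data.Sum using (_⊎_; inj₁; inj₂)
open import Data.Vec using (Vec; []; _∷_; map; lookup; tabulate)
open import Data.Vec.Properties using (lookup∘tabulate)
open import Function using (_⇔_; mk⇔; Equivalence)
open import Relation.Binary using (tri<; tri≈; tri>)
open import Relation.Binary.PropositionalEquality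
  using (_≡_; _≢_; refl; sym; trans)
open import Relation.Nullary using (¬_; Dec; yes; no; does; contradiction)
open import Relation.Nullary.Decidable using (map′; _×-dec_; _→-dec_; _⊎-dec_; ¬?)
open import Relation.Unary using (Pred; Decidable)
open import Level using (0ℓ)

-- A digraph on the vertex set Fin n is its n × n adjacency matrix. As a
-- Subset n is a vector of Booleans, row u is both the u-th row of the
-- matrix (1 being true) and the set of successors of u. Loops are allowed.
-- The value n = 0 is not excluded here.

Digraph : ℕ → Set
Digraph n = Vec (Subset n) n

successors : ∀ {n} → Digraph n → Fin n → Subset n
successors = lookup

Edge : ∀ {n} → Digraph n → Fin n → Fin n → Set
Edge D u v = v ∈ successors D u

complement : ∀ {n} → Digraph n → Digraph n
complement = map ∁

Ferrers : ∀ {n} → Digraph n → Set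
Ferrers D = ∀ u v →
  successors D u ⊆ successors D v ⊎ successors D v ⊆ successors D u

Disjoint : ∀ {n} → Digraph n → Digraph n → Set
Disjoint D E = ∀ u v → ¬ (Edge D u v × Edge E u v)

-- Members of the family may be empty; this does not affect the minimum
-- number of members.

record IsFerrersPartition {n t} (D : Digraph n) (F : Vec (Digraph n) t) : Set where
  constructor isFerrersPartition
  field
    ferrers  : ∀ i → Ferrers (lookup F i)
    disjoint : ∀ i j → i ≢ j → Disjoint (lookup F i) (lookup F j)
    union    : ∀ u v → Edge D u v ⇔ (∃ λ i → Edge (lookup F i) u v)

FerrersPartitionable : ∀ {n} → Digraph n → ℕ → Set
FerrersPartitionable {n} D t = ∃ λ (F : Vec (Digraph n) t) → IsFerrersPartition D F

IsMinimum : Pred ℕ 0ℓ → ℕ → Set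
IsMinimum P s = P s × (∀ t → P t → s ≤ t)

-- To define f* as a function, its defining property is shown to be
-- decidable and to hold for some number of digraphs.

Searchable : Set → Set₁
Searchable A = {P : Pred A 0ℓ} → Decidable P → Dec (∃ P)

searchBool : Searchable Bool
searchBool P? with P? true | P? false
... | yes p | _     = yes (true , p)
... | no _  | yes p = yes (false , p)
... | no ¬p | no ¬q = no λ { (true , p) → ¬p p ; (false , q) → ¬q q }

searchVec : ∀ {A} → Searchable A → ∀ n → Searchable (Vec A n)
searchVec s zero    P? = map′ ([] ,_) (λ { ([] , p) → p }) (P? [])
searchVec s (suc n) P? =
  map′ (λ { (x , xs , p) → x ∷ xs , p }) (λ { (x ∷ xs , p) → x , xs , p })
       (s λ x → searchVec s n λ xs → P? (x ∷ xs))

ferrers? : ∀ {n} → Decidable (Ferrers {n})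
ferrers? D = all? λ u → all? λ v →
  (successors D u ⊆? successors D v) ⊎-dec (successors D v ⊆? successors D u)

edge? : ∀ {n} (D : Digraph n) u v → Dec (Edge D u v)
edge? D u v = v ∈? successors D u

isFerrersPartition? : ∀ {n t} (D : Digraph n) (F : Vec (Digraph n) t) →
                      Dec (IsFerrersPartition D F)
isFerrersPartition? D F =
  map′ (λ (f , d , u) → isFerrersPartition f d
          λ x y → mk⇔ (proj₁ (u x y)) (proj₂ (u x y)))
       (λ p → let open IsFerrersPartition p in ferrers , disjoint ,
          λ x y → Equivalence.to (union x y) , Equivalence.from (union x y))
       ((all? λ i → ferrers? (lookup F i))
        ×-dec (all? λ i → all? λ j → ¬? (i ≟ j) →-dec
                 (all? λ u → all? λ v →
                   ¬? (edge? (lookup F i) u v ×-dec edge? (lookup F j) u v)))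
        ×-dec (all? λ u → all? λ v →
                 let lhs = edge? D u v
                     rhs = any? λ i → edge? (lookup F i) u v
                 in (lhs →-dec rhs) ×-dec (rhs →-dec lhs)))

ferrersPartitionable? : ∀ {n} (D : Digraph n) → Decidable (FerrersPartitionable D)
ferrersPartitionable? {n} D t =
  searchVec (searchVec (searchVec searchBool n) n) t (isFerrersPartition? D)

-- Every digraph is partitioned by the digraphs consisting of all edges
-- leaving a fixed vertex.

module _ {n} (D : Digraph n) where

  private
    starRow : ∀ {i u : Fin n} → Dec (i ≡ u) → Subset n
    starRow {u = u} (yes _) = successors D u
    starRow         (no _)  = ⊥

    star : Fin n → Digraph n
    star i = tabulate λ u → starRow (i ≟ u)

    stars : Vec (Digraph n) n
    stars = tabulate star

    row : ∀ i u → successors (lookup stars i) u ≡ starRow (i ≟ u)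
    row i u rewrite lookup∘tabulate star i = lookup∘tabulate _ u

    starFerrers : ∀ i → Ferrers (lookup stars i)
    starFerrers i u v rewrite row i u | row i v with i ≟ u | i ≟ v
    ... | yes refl | yes refl = inj₁ ⊆-refl
    ... | no _     | _        = inj₁ ⊥⊆
    ... | yes _    | no _     = inj₂ ⊥⊆

    fromStar : ∀ i u v → Edge (lookup stars i) u v → i ≡ u × Edge D u v
    fromStar i u v e rewrite row i u with i ≟ u
    ... | yes i≡u = i≡u , e
    ... | no _    = contradiction e ∉⊥

    toStar : ∀ u v → Edge D u v → Edge (lookup stars u) u v
    toStar u v e rewrite row u u with u ≟ u
    ... | yes _  = e
    ... | no u≢u = contradiction refl u≢u

  starPartition : FerrersPartitionable D n
  starPartition = stars , isFerrersPartition starFerrers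
    (λ i j i≢j u v (e , e′) → i≢j
      (trans (proj₁ (fromStar i u v e)) (sym (proj₁ (fromStar j u v e′)))))
    (λ u v → mk⇔ (λ e → u , toStar u v e) (λ (i , e) → proj₂ (fromStar i u v e)))

minimum : {P : Pred ℕ 0ℓ} → Decidable P → ∀ n → P n → ∃ (IsMinimum P)
minimum P? n p with P? 0
minimum P? n       p | yes p₀ = 0 , p₀ , λ _ _ → z≤n
minimum P? zero    p | no ¬p₀ = contradiction p ¬p₀
minimum P? (suc n) p | no ¬p₀ =
  let s , ps , least = minimum (λ t → P? (suc t)) n p
  in suc s , ps , λ { zero q → contradiction q ¬p₀ ; (suc t) q → s≤s (least t q) }

f*-minimum : ∀ {n} (D : Digraph n) → ∃ (IsMinimum (FerrersPartitionable (complement D)))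
f*-minimum {n} D =
  minimum (ferrersPartitionable? (complement D)) n (starPartition (complement D))

f* : ∀ {n} → Digraph n → ℕ
f* D = proj₁ (f*-minimum D)

f*-isMinimum : ∀ {n} (D : Digraph n) →
               IsMinimum (FerrersPartitionable (complement D)) (f* D)
f*-isMinimum D = proj₂ (f*-minimum D)

-- Entry in row r and column s of the block in block row i and block column j.

M-entry : ∀ {k m} (i j : Fin k) (r s : Fin m) → Bool
M-entry i j r s with <-cmp i j
... | tri< _ _ _ = true
... | tri≈ _ _ _ = does (r ≟ s)
... | tri> _ _ _ = false

-- Row or column number q * m + r (with r < m) has block number q and
-- position r in its block.

M : ∀ k m → Digraph (k * m)
M k m = tabulate λ u → tabulate λ v →
  M-entry (quotient {k} m u) (quotient {k} m v) (remainder {k} m u) (remainder {k} m v)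

{-# OPTIONS --safe #-}

-- Write A(s) for the set of colours in column s of a diagonal block and B(r)
-- for the set of colours in row r. If i < j, a column s of block i and a row r
-- of block j share at most one colour: by the Ferrers property the cell (r , s)
-- below the diagonal gets every shared colour. So if every block has a column
-- and a row sharing two colours, these pairs differ and k ≤ c C 2.
--
-- It remains to bound a block in which every row and column share at most one
-- colour. A row with all c colours makes every column monochromatic, so m ≤ c.
-- Otherwise some row x has the same colour a in the columns of a large set S;
-- at most one row of S × S contains a, and deleting its index leaves a block
-- with one colour less.

module Submission where

open import Defs
open import Data.Nat using (ℕ; NonZero; _+_; _*_; _≥_; _>_; _!)
open import Data.Nat.Combinatorics using (_C_)

open import Data.Nat using (zero; suc; _≤_; _<_; z≤n; s≤s; _<?_; _≤′_; ≤′-refl; ≤′-step; >-nonZero)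
open import Data.Nat.Properties as ℕ using (module ≤-Reasoning)
open import Data.Nat.Combinatorics using (nCk+nC[k+1]≡[n+1]C[k+1]; nC1≡n)
open import Data.Bool using (true; false)
open import Data.Empty using (⊥)
open import Data.Fin as Fin using (Fin; toℕ; fromℕ<; combine)
open import Data.Fin.Properties as Fin
  using (toℕ<n; toℕ-injective; fromℕ<-injective; pigeonhole; remQuot-combine; any?)
open import Data.Fin.Subset using (∁) renaming (_∈_ to _∈ˢ_)
open import Data.Fin.Subset.Properties using (x∈∁p⇒x∉p; x∉p⇒x∈∁p)
open import Data.List using (List; []; _∷_; length; filter; allFin)
open import Data.List.Properties using (filter-all; filter-notAll; length-tabulate)
open import Data.List.Membership.Propositional using (_∈_; find; lose)
open import Data.List.Membership.Propositional.Properties using (∈-filter⁺; ∈-filter⁻; ∈-allFin)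
open import Data.List.Relation.Unary.All as All using (All; []; _∷_)
open import Data.List.Relation.Unary.All.Properties using (¬All⇒Any¬)
open import Data.List.Relation.Unary.AllPairs using ([]; _∷_)
open import Data.List.Relation.Unary.Any as Any using (Any; here; there)
open import Data.List.Relation.Unary.Unique.Propositional using (Unique)
import Data.List.Relation.Unary.Unique.Propositional.Properties as Unique
open import Data.Product using (∃; ∃₂; _×_; _,_; proj₁; proj₂)
open import Data.Sum using (inj₁; inj₂)
open import Data.Vec using (Vec; lookup)
open import Data.Vec.Properties using (lookup-map; lookup∘tabulate; []=⇒lookup; lookup⇒[]=)
open import Function using (_∘_; Equivalence)
open import Relation.Binary using (DecidableEquality; tri<; tri≈; tri>)
open import Relation.Binary.PropositionalEquality
  using (_≡_; _≢_; refl; sym; trans; cong; cong₂; subst; subst₂; ≢-sym; module ≡-Reasoning)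
open import Relation.Nullary using (¬_; Dec; yes; no; does; contradiction)
open import Relation.Nullary.Decidable using (¬?; _×-dec_; dec-false; dec-true)
open import Relation.Unary using (Decidable)

-- Counting in lists: removal, fibres, two-valued choices

length-filter-∁ : ∀ {A : Set} {P : A → Set} (P? : Decidable P) xs →
                  length xs ≡ length (filter P? xs) + length (filter (¬? ∘ P?) xs)
length-filter-∁ P? []       = refl
length-filter-∁ P? (x ∷ xs) with P? x
... | yes _ = cong suc (length-filter-∁ P? xs)
... | no _  = trans (cong suc (length-filter-∁ P? xs)) (sym (ℕ.+-suc _ _))

module _ {A : Set} (_≟_ : DecidableEquality A) where

  remove : A → List A → List A
  remove x = filter λ y → ¬? (y ≟ x)

  length-remove : ∀ {x xs} → x ∈ xs → length (remove x xs) < length xs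
  length-remove x∈xs = filter-notAll _ _ (lose x∈xs λ x≢x → x≢x refl)

  length-remove-unique : ∀ x {xs} → Unique xs → length xs ≤ suc (length (remove x xs))
  length-remove-unique x                []      = z≤n
  length-remove-unique x {y ∷ ys} (y∉ys ∷ u) with y ≟ x
  ... | yes refl = s≤s (ℕ.≤-reflexive (cong length (sym
                     (filter-all (λ z → ¬? (z ≟ x)) (All.map ≢-sym y∉ys)))))
  ... | no _     = s≤s (length-remove-unique x u)

  -- Induction on `cs`: if the fibre over `c` has at most `n` elements, the rest of `xs` still has
  -- more than `n` per remaining value.
  pigeonhole-fibre : ∀ {B : Set} (g : B → A) n {xs} cs → Unique xs →
    (∀ {x} → x ∈ xs → g x ∈ cs) → length cs * n < length xs →
    ∃₂ λ a ys → a ∈ cs × n < length ys × Unique ys ×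
                (∀ {y} → y ∈ ys → y ∈ xs × g y ≡ a)
  pigeonhole-fibre g n {_ ∷ _} [] u into _ = contradiction (into (here refl)) λ ()
  pigeonhole-fibre g n {xs} (c ∷ cs) u into big
    with n <? length (filter (λ x → g x ≟ c) xs)
  ... | yes n< = c , _ , here refl , n< , Unique.filter⁺ _ u , ∈-filter⁻ (λ x → g x ≟ c)
  ... | no n≮ =
    let a , ys , a∈ , n< , uys , fibre =
          pigeonhole-fibre g n cs (Unique.filter⁺ other? u) into′
            (ℕ.+-cancelˡ-< n _ _ (ℕ.<-≤-trans big (subst (_≤ n + length rest)
              (sym (length-filter-∁ (λ x → g x ≟ c) xs))
              (ℕ.+-monoˡ-≤ (length rest) (ℕ.≮⇒≥ n≮)))))
    in a , ys , there a∈ , n< , uys ,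
       λ y∈ → proj₁ (∈-filter⁻ other? (proj₁ (fibre y∈))) , proj₂ (fibre y∈)
    where
    other? = λ x → ¬? (g x ≟ c)
    rest = filter other? xs
    into′ : ∀ {x} → x ∈ rest → g x ∈ cs
    into′ x∈ with ∈-filter⁻ other? x∈
    ... | x∈xs , gx≢c with into x∈xs
    ...   | here gx≡c = contradiction gx≡c gx≢c
    ...   | there gx∈ = gx∈

-- Of two available values, avoiding `q` leaves one. In the two-colour case this turns inequalities
-- of colours into equalities.
∈-pair-unique : ∀ {A : Set} {cs : List A} {p q r} → length cs ≤ 2 →
                p ∈ cs → q ∈ cs → r ∈ cs → p ≢ q → r ≢ q → p ≡ r
∈-pair-unique {cs = _ ∷ []} _ (here refl) _ (here refl) _ _ = refl
∈-pair-unique {cs = _ ∷ _ ∷ []} _ (here refl) _ (here refl) _ _ = refl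
∈-pair-unique {cs = _ ∷ _ ∷ []} _ (there (here refl)) _ (there (here refl)) _ _ = refl
∈-pair-unique {cs = _ ∷ _ ∷ []} _ (here refl) (here refl) (there (here refl)) p≢q _ =
  contradiction refl p≢q
∈-pair-unique {cs = _ ∷ _ ∷ []} _ (here refl) (there (here refl)) (there (here refl)) _ r≢q =
  contradiction refl r≢q
∈-pair-unique {cs = _ ∷ _ ∷ []} _ (there (here refl)) (here refl) (here refl) _ r≢q =
  contradiction refl r≢q
∈-pair-unique {cs = _ ∷ _ ∷ []} _ (there (here refl)) (there (here refl)) (here refl) p≢q _ =
  contradiction refl p≢q
∈-pair-unique {cs = _ ∷ _ ∷ _ ∷ _} (s≤s (s≤s ())) _ _ _ _ _

-- Arithmetic of the block size

-- This is 3 (2 + d)! / 2, the bound for 2 + d colours.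
blockSize : ℕ → ℕ
blockSize zero    = 3
blockSize (suc d) = (3 + d) * blockSize d

2*blockSize : ∀ d → 2 * blockSize d ≡ 3 * (2 + d) !
2*blockSize zero    = refl
2*blockSize (suc d) = begin
  2 * ((3 + d) * blockSize d) ≡⟨ x∙yz≈y∙xz 2 (3 + d) (blockSize d) ⟩
  (3 + d) * (2 * blockSize d) ≡⟨ cong ((3 + d) *_) (2*blockSize d) ⟩
  (3 + d) * (3 * (2 + d) !)   ≡⟨ x∙yz≈y∙xz (3 + d) 3 ((2 + d) !) ⟩
  3 * ((3 + d) * (2 + d) !)   ∎
  where
  open ≡-Reasoning
  open import Algebra.Properties.CommutativeSemigroup ℕ.*-commutativeSemigroup
    using (x∙yz≈y∙xz)

blockSize≥3 : ∀ d → 3 ≤ blockSize d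
blockSize≥3 zero    = ℕ.≤-refl
blockSize≥3 (suc d) = ℕ.≤-trans (blockSize≥3 d) (ℕ.m≤m+n _ _)

-- For the pigeonhole step: a row of a square of side `suc n` has `n` off-diagonal cells, so if only
-- `2 + d` colours occur there, one of them fills more than `blockSize d` cells.
blockSize-step : ∀ d {n} → blockSize (suc d) ≤ suc n → (2 + d) * blockSize d < n
blockSize-step d {n} p = ℕ.≤-pred (begin
  2 + (2 + d) * blockSize d           ≤⟨ ℕ.+-monoˡ-≤ _ (ℕ.≤-trans (ℕ.n≤1+n 2) (blockSize≥3 d)) ⟩
  blockSize d + (2 + d) * blockSize d ≤⟨ p ⟩
  suc n                               ∎)
  where open ≤-Reasoning

3+d≤[2+d]*blockSize : ∀ d → 3 + d ≤ (2 + d) * blockSize d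
3+d≤[2+d]*blockSize d = begin
  3 + d                               ≤⟨ ℕ.+-mono-≤ (blockSize≥3 d) (ℕ.≤-trans (ℕ.n≤1+n d) (ℕ.m≤m*n (suc d) (blockSize d))) ⟩
  blockSize d + (1 + d) * blockSize d ∎
  where
  open ≤-Reasoning
  instance
    blockSize-nonZero : NonZero (blockSize d)
    blockSize-nonZero = >-nonZero (ℕ.≤-trans (s≤s z≤n) (blockSize≥3 d))

-- Blocks whose rows and columns share at most one colour

-- col colours the off-diagonal cells of a square; its diagonal values are junk.
-- The last hypothesis says that a row r and a column s share at most one colour.

module Block
  {V K : Set} (_≟V_ : DecidableEquality V) (_≟K_ : DecidableEquality K)
  (col : V → V → K)
  (antisym : ∀ {x y} → x ≢ y → col x y ≢ col y x)
  (share : ∀ {r s y y′ z z′} → r ≢ z → r ≢ z′ → y ≢ s → y′ ≢ s →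
           col y s ≡ col r z → col y′ s ≡ col r z′ → col r z ≡ col r z′)
  where

  Palette : List K → List V → Set
  Palette cs vs = ∀ {x y} → x ∈ vs → y ∈ vs → x ≢ y → col x y ∈ cs

  -- If row `x` has two colours, `antisym` puts both into column `x` as well. If it has one, that
  -- colour also occurs at `(y , z)` or `(z , y)`, as these differ; then row and column `y`,
  -- respectively `z`, share both colours.
  noThree : ∀ {x y z vs cs} → length cs ≤ 2 → Palette cs vs →
            x ∈ vs → y ∈ vs → z ∈ vs → x ≢ y → x ≢ z → y ≢ z → ⊥
  noThree {x} {y} {z} {vs} l pal x∈ y∈ z∈ x≢y x≢z y≢z with col x y ≟K col x z
  ... | no ne = ne (share x≢y x≢z (≢-sym x≢z) (≢-sym x≢y)
          (∈-pair-unique l (pal z∈ x∈ (≢-sym x≢z)) (pal x∈ z∈ x≢z) (pal x∈ y∈ x≢y)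
             (≢-sym (antisym x≢z)) ne)
          (∈-pair-unique l (pal y∈ x∈ (≢-sym x≢y)) (pal x∈ y∈ x≢y) (pal x∈ z∈ x≢z)
             (≢-sym (antisym x≢y)) (≢-sym ne)))
  ... | yes e = rows e
    where
    same : ∀ {y z} → y ∈ vs → z ∈ vs → x ≢ y → x ≢ z → y ≢ z →
           col x y ≡ col x z → col y z ≡ col x y → ⊥
    same y∈ z∈ x≢y x≢z y≢z e e′ = antisym x≢y (trans (sym e′)
      (share y≢z (≢-sym x≢y) x≢y (≢-sym y≢z) (sym e′)
        (∈-pair-unique l (pal z∈ y∈ (≢-sym y≢z)) (pal y∈ z∈ y≢z) (pal y∈ x∈ (≢-sym x≢y))
          (≢-sym (antisym y≢z)) λ q → antisym x≢y (trans (sym e′) (sym q)))))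
    rows : col x y ≡ col x z → ⊥
    rows e with col y z ≟K col x y
    ... | yes e′ = same y∈ z∈ x≢y x≢z y≢z e e′
    ... | no ne  = same z∈ y∈ x≢z x≢y (≢-sym y≢z) (sym e)
      (trans (∈-pair-unique l (pal z∈ y∈ (≢-sym y≢z)) (pal y∈ z∈ y≢z) (pal x∈ y∈ x≢y)
        (≢-sym (antisym y≢z)) (≢-sym ne)) e)

  -- Every colour of a column `s` occurs in row `x`, hence equals the colour of `(x , s)`. With more
  -- columns than colours, two columns `s` and `s′` agree, and the cells `(s , s′)` and `(s′ , s)`
  -- contradict `antisym`.
  noFullRow : ∀ {x ys cs} → Unique (x ∷ ys) → Palette cs (x ∷ ys) →
              All (λ a → Any (λ s → col x s ≡ a) ys) cs →
              ¬ length cs < length ys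
  noFullRow {x} {ys} {cs} (x∉ ∷ u) pal full big
    with pigeonhole-fibre _≟K_ (col x) 1 cs u
           (λ s∈ → pal (here refl) (there s∈) (All.lookup x∉ s∈))
           (subst (_< _) (sym (ℕ.*-identityʳ _)) big)
  ... | a , s ∷ s′ ∷ _ , _ , _ , ((s≢s′ ∷ _) ∷ _) , fibre =
    let s∈ , xs≡a   = fibre (here refl)
        s′∈ , xs′≡a = fibre (there (here refl))
    in antisym s≢s′ (trans (monochromatic (there s∈) s′∈ s≢s′)
         (trans xs′≡a (trans (sym xs≡a) (sym (monochromatic (there s′∈) s∈ (≢-sym s≢s′))))))
    where
    monochromatic : ∀ {y s} → y ∈ x ∷ ys → s ∈ ys → y ≢ s → col y s ≡ col x s
    monochromatic y∈ s∈ y≢s =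
      let _ , z∈ , e = find (All.lookup full (pal y∈ (there s∈) y≢s))
          x≢s = All.lookup x∉ s∈
      in trans (sym e) (share (All.lookup x∉ z∈) x≢s y≢s x≢s (sym e) refl)
  ... | _ , []     , _ , ()     , _
  ... | _ , _ ∷ [] , _ , s≤s () , _

  -- A row r′ of S × S containing a has only a in S × S: every column of S
  -- already contains a, from row x.
  fullRowUnique : ∀ {x a r r′ s s′ S} → (∀ {s} → s ∈ S → x ≢ s × col x s ≡ a) →
    r′ ∈ S → s′ ∈ S → r′ ≢ s′ → col r′ s′ ≡ a →
    r ∈ S → s ∈ S → r ≢ s → r ≢ r′ → col r s ≢ a
  fullRowUnique {a = a} {S = S} fibre r′∈ s′∈ r′≢s′ e′ r∈ s∈ r≢s r≢r′ e =
    antisym r≢r′ (trans (fill r∈ s∈ r≢s e r′∈ r≢r′) (sym (fill r′∈ s′∈ r′≢s′ e′ r∈ (≢-sym r≢r′))))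
    where
    fill : ∀ {r s q} → r ∈ S → s ∈ S → r ≢ s → col r s ≡ a → q ∈ S → r ≢ q → col r q ≡ a
    fill r∈ s∈ r≢s e q∈ r≢q =
      let x≢q , xq≡a = fibre q∈
      in trans (sym (share r≢s r≢q x≢q r≢q (trans xq≡a (sym e)) refl)) e

  -- Induction on the number of colours, starting from `noThree`. The first vertex serves as the row
  -- `x`.
  tooLarge : ∀ d {vs cs} → Unique vs → Palette cs vs → length cs ≤ 2 + d →
             ¬ blockSize d ≤ length vs
  tooLarge zero {x ∷ y ∷ z ∷ _} ((x≢y ∷ x≢z ∷ _) ∷ (y≢z ∷ _) ∷ _) pal l _ =
    noThree l pal (here refl) (there (here refl)) (there (there (here refl))) x≢y x≢z y≢z
  tooLarge zero {_ ∷ _ ∷ []} _ _ _ (s≤s (s≤s ()))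
  tooLarge zero {_ ∷ []} _ _ _ (s≤s ())
  tooLarge (suc d) {[]} _ _ _ big with ℕ.≤-trans (blockSize≥3 (suc d)) big
  ... | ()
  tooLarge (suc d) {x ∷ ys} {cs} u@(x∉ ∷ uys) pal l big
    with All.all? (λ a → Any.any? (λ s → col x s ≟K a) ys) cs
  ... | yes full = noFullRow u pal full
          (ℕ.≤-<-trans (ℕ.≤-trans l (3+d≤[2+d]*blockSize d)) (blockSize-step d big))
  ... | no ¬full
    with find (¬All⇒Any¬ (λ a → Any.any? (λ s → col x s ≟K a) ys) cs ¬full)
  ... | a₀ , a₀∈ , missing
    -- Row `x` misses `a₀`, so at most `2 + d` colours compete for its cells; this is why the factor
    -- `3 + d` in `blockSize` suffices.
    with pigeonhole-fibre _≟K_ (col x) (blockSize d) (remove _≟K_ a₀ cs) uys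
           (λ s∈ → ∈-filter⁺ (λ y → ¬? (y ≟K a₀))
             (pal (here refl) (there s∈) (All.lookup x∉ s∈)) (missing ∘ lose s∈))
           (ℕ.≤-<-trans (ℕ.*-monoˡ-≤ (blockSize d)
             (ℕ.≤-pred (ℕ.≤-trans (length-remove _≟K_ a₀∈) l))) (blockSize-step d big))
  ... | a , S , a∈′ , n<S , uS , fibre
    with Any.any? (λ r → Any.any? (λ s → ¬? (r ≟V s) ×-dec (col r s ≟K a)) S) S
  ... | no ¬used = tooLarge d uS
          (λ r∈ s∈ r≢s → ∈-filter⁺ (λ y → ¬? (y ≟K a))
            (pal (there (proj₁ (fibre r∈))) (there (proj₁ (fibre s∈))) r≢s)
            λ e → ¬used (lose r∈ (lose s∈ (r≢s , e))))
          (ℕ.≤-pred (ℕ.≤-trans (length-remove _≟K_ {xs = cs} a∈) l))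
          (ℕ.<⇒≤ n<S)
    where a∈ = proj₁ (∈-filter⁻ (λ y → ¬? (y ≟K a₀)) {xs = cs} a∈′)
  ... | yes used =
    -- A second row containing `a` would put `a` into two mirrored cells, so deleting `r′` frees the
    -- square of `a`. The strictness of `n<S` pays for this deletion.
    let r′ , r′∈ , used′       = find used
        s′ , s′∈ , r′≢s′ , e′ = find used′
        T⊆S                    = ∈-filter⁻ λ y → ¬? (y ≟V r′)
    in tooLarge d (Unique.filter⁺ (λ y → ¬? (y ≟V r′)) uS)
          (λ r∈ s∈ r≢s →
            let r∈S , r≢r′ = T⊆S r∈
                s∈S , _    = T⊆S s∈
            in ∈-filter⁺ (λ y → ¬? (y ≟K a))
              (pal (there (proj₁ (fibre r∈S))) (there (proj₁ (fibre s∈S))) r≢s)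
              (fullRowUnique (λ s∈ → All.lookup x∉ (proj₁ (fibre s∈)) , proj₂ (fibre s∈))
                 r′∈ s′∈ r′≢s′ e′ r∈S s∈S r≢s r≢r′))
          (ℕ.≤-pred (ℕ.≤-trans (length-remove _≟K_ {xs = cs} a∈) l))
          (ℕ.≤-pred (ℕ.≤-trans n<S (length-remove-unique _≟V_ r′ uS)))
    where a∈ = proj₁ (∈-filter⁻ (λ y → ¬? (y ≟K a₀)) {xs = cs} a∈′)

-- Coding pairs of colours

sucC2 : ∀ n → suc n C 2 ≡ n C 2 + n
sucC2 n = trans (sym (nCk+nC[k+1]≡[n+1]C[k+1] n 1))
  (trans (cong (_+ n C 2) (nC1≡n n)) (ℕ.+-comm n _))

C2-mono : ∀ {m n} → m ≤ n → m C 2 ≤ n C 2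
C2-mono = go ∘ ℕ.≤⇒≤′
  where
  go : ∀ {m n} → m ≤′ n → m C 2 ≤ n C 2
  go ≤′-refl = ℕ.≤-refl
  go {m} (≤′-step {n} p) = ℕ.≤-trans (go p)
    (subst (n C 2 ≤_) (sym (sucC2 n)) (ℕ.m≤m+n _ n))

-- The colexicographic rank of a pair `a < b`: pairs with larger entry `b` fill the interval from
-- `b C 2` up to, but excluding, `suc b C 2`.
pairCode : ℕ → ℕ → ℕ
pairCode a b = b C 2 + a

pairCode<C2 : ∀ {a b n} → a < b → b < n → pairCode a b < n C 2
pairCode<C2 {a} {b} a<b b<n = ℕ.<-≤-trans
  (subst (pairCode a b <_) (sym (sucC2 b)) (ℕ.+-monoʳ-< (b C 2) a<b)) (C2-mono b<n)

pairCode-injective : ∀ {a b a′ b′} → a < b → a′ < b′ →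
                     pairCode a b ≡ pairCode a′ b′ → a ≡ a′ × b ≡ b′
pairCode-injective {a} {b} {a′} {b′} a<b a′<b′ e with ℕ.<-cmp b b′
... | tri≈ _ refl _ = ℕ.+-cancelˡ-≡ (b C 2) a a′ e , refl
... | tri< b<b′ _ _ = contradiction e
      (ℕ.<⇒≢ (ℕ.<-≤-trans (pairCode<C2 a<b b<b′) (ℕ.m≤m+n _ a′)))
... | tri> _ _ b′<b = contradiction (sym e)
      (ℕ.<⇒≢ (ℕ.<-≤-trans (pairCode<C2 a′<b′ b′<b) (ℕ.m≤m+n _ a)))

-- Entries of the matrix and of its complement

module _ (k m : ℕ) where

  vertex : Fin k → Fin m → Fin (k * m)
  vertex = combine

  M-vertex : ∀ i j r s → lookup (lookup (M k m) (vertex i r)) (vertex j s) ≡ M-entry i j r s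
  M-vertex i j r s = trans
    (trans (cong (λ p → lookup p v) (lookup∘tabulate _ u)) (lookup∘tabulate _ v))
    (cong₂ (λ (i , r) (j , s) → M-entry i j r s) (remQuot-combine i r) (remQuot-combine j s))
    where
    u = vertex i r
    v = vertex j s

  ∁M-edge : ∀ i j r s → M-entry i j r s ≡ false →
            Edge (complement (M k m)) (vertex i r) (vertex j s)
  ∁M-edge i j r s e =
    subst (vertex j s ∈ˢ_) (sym (lookup-map (vertex i r) ∁ (M k m)))
    (x∉p⇒x∈∁p λ h → contradiction
      (trans (sym e) (trans (sym (M-vertex i j r s)) ([]=⇒lookup h))) λ ())

  ∁M-nonedge : ∀ i j r s → M-entry i j r s ≡ true →
               ¬ Edge (complement (M k m)) (vertex i r) (vertex j s)
  ∁M-nonedge i j r s e h =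
    x∈∁p⇒x∉p (subst (vertex j s ∈ˢ_) (lookup-map (vertex i r) ∁ (M k m)) h)
      (lookup⇒[]= _ _ (trans (M-vertex i j r s) e))

  M-entry-diagonal : ∀ (i : Fin k) (r s : Fin m) → M-entry i i r s ≡ does (r Fin.≟ s)
  M-entry-diagonal i r s with Fin.<-cmp i i
  ... | tri< _ i≢i _ = contradiction refl i≢i
  ... | tri≈ _ _ _   = refl
  ... | tri> _ i≢i _ = contradiction refl i≢i

  M-entry-loop : ∀ (i : Fin k) (r : Fin m) → M-entry i i r r ≡ true
  M-entry-loop i r = trans (M-entry-diagonal i r r) (dec-true (r Fin.≟ r) refl)

  M-entry-above : ∀ {i j : Fin k} (r s : Fin m) → i Fin.< j → M-entry i j r s ≡ true
  M-entry-above {i} {j} r s i<j with Fin.<-cmp i j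
  ... | tri< _ _ _   = refl
  ... | tri≈ i≮j _ _ = contradiction i<j i≮j
  ... | tri> i≮j _ _ = contradiction i<j i≮j

  -- The colouring given by a Ferrers partition

  module Colouring {t} {F : Vec (Digraph (k * m)) t}
                   (partition : IsFerrersPartition (complement (M k m)) F) (default : Fin t) where
    open IsFerrersPartition partition

    Cell : Fin t → Fin k → Fin k → Fin m → Fin m → Set
    Cell a i j r s = Edge (lookup F a) (vertex i r) (vertex j s)

    nonCell : ∀ {a} i j r s → M-entry i j r s ≡ true → ¬ Cell a i j r s
    nonCell i j r s e h = ∁M-nonedge i j r s e (Equivalence.from (union _ _) (_ , h))

    colour : Fin k → Fin m → Fin m → Fin t
    colour i r s with r Fin.≟ s
    -- Diagonal cells lie in no member of the partition; `default` makes `colour` total.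
    ... | yes _  = default
    ... | no r≢s = proj₁ (Equivalence.to (union (vertex i r) (vertex i s))
                     (∁M-edge i i r s (trans (M-entry-diagonal i r s) (dec-false (r Fin.≟ s) r≢s))))

    colour-cell : ∀ i {r s} → r ≢ s → Cell (colour i r s) i i r s
    colour-cell i {r} {s} r≢s with r Fin.≟ s
    ... | yes r≡s = contradiction r≡s r≢s
    ... | no _    = proj₂ (Equivalence.to (union _ _) _)

    -- If one Ferrers digraph contained both mirrored cells, comparability of the two rows would add
    -- the loop at `x` or at `y`, but loops are edges of `M`.
    colour-antisym : ∀ i {x y} → x ≢ y → colour i x y ≢ colour i y x
    colour-antisym i {x} {y} x≢y e
      with ferrers (colour i y x) (vertex i x) (vertex i y)
         | subst (λ a → Cell a i i x y) e (colour-cell i x≢y)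
         | colour-cell i (≢-sym x≢y)
    ... | inj₁ sub | xy | yx = nonCell i i y y (M-entry-loop i y) (sub xy)
    ... | inj₂ sub | xy | yx = nonCell i i x x (M-entry-loop i x) (sub yx)

    InRow InColumn : Fin k → Fin m → Fin t → Set
    InRow    i r a = ∃ λ z → r ≢ z × colour i r z ≡ a
    InColumn i s a = ∃ λ y → y ≢ s × colour i y s ≡ a

    -- The order `a < b` makes each unordered pair of colours count once.
    SharedPair : Fin k → Fin t → Fin t → Set
    SharedPair i a b = a Fin.< b × ∃ (λ r → InRow i r a × InRow i r b)
                                 × ∃ (λ s → InColumn i s a × InColumn i s b)

    inRow? : ∀ i r a → Dec (InRow i r a)
    inRow? i r a = any? λ z → ¬? (r Fin.≟ z) ×-dec (colour i r z Fin.≟ a)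

    inColumn? : ∀ i s a → Dec (InColumn i s a)
    inColumn? i s a = any? λ y → ¬? (y Fin.≟ s) ×-dec (colour i y s Fin.≟ a)

    sharedPair? : ∀ i → Dec (∃₂ (SharedPair i))
    sharedPair? i = any? λ a → any? λ b → (a Fin.<? b)
      ×-dec any? (λ r → inRow? i r a ×-dec inRow? i r b)
      ×-dec any? (λ s → inColumn? i s a ×-dec inColumn? i s b)

    -- The cells `(y , s)` of block `i` and `(r , z)` of block `j` are opposite corners of a 2 × 2
    -- submatrix. The corner `(y , z)` lies above the diagonal, outside the complement, so the
    -- Ferrers property forces the corner `(r , s)`.
    below : ∀ {i j r s a} → i Fin.< j → InColumn i s a → InRow j r a → Cell a j i r s
    below {i} {j} {r} {s} {a} i<j (y , y≢s , e) (z , r≢z , e′)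
      with ferrers a (vertex j r) (vertex i y)
         | subst (λ a → Cell a i i y s) e (colour-cell i y≢s)
         | subst (λ a → Cell a j j r z) e′ (colour-cell j r≢z)
    ... | inj₁ sub | ys | rz = contradiction (sub rz) (nonCell i j y z (M-entry-above y z i<j))
    ... | inj₂ sub | ys | rz = sub ys

    sharedPair-disjoint : ∀ {i j a b} → i Fin.< j → SharedPair i a b → ¬ SharedPair j a b
    sharedPair-disjoint i<j (a<b , _ , s , sa , sb) (_ , (r , ra , rb) , _) =
      disjoint _ _ (Fin.<⇒≢ a<b) _ _ (below i<j sa ra , below i<j sb rb)

    sharedPair-bound : (∀ i → ∃₂ (SharedPair i)) → k ≤ t C 2
    sharedPair-bound pair = ℕ.≮⇒≥ λ big →
      let i , j , i<j , e = pigeonhole big code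
          ai , bi , pi = pair i
          aj , bj , pj = pair j
          a≡ , b≡ = pairCode-injective (proj₁ pi) (proj₁ pj)
                      (fromℕ<-injective _ _ (code< i) (code< j) e)
      in sharedPair-disjoint i<j pi
           (subst₂ (SharedPair j) (sym (toℕ-injective a≡)) (sym (toℕ-injective b≡)) pj)
      where
      code< : ∀ i → pairCode (toℕ (proj₁ (pair i))) (toℕ (proj₁ (proj₂ (pair i)))) < t C 2
      code< i = pairCode<C2 (proj₁ (proj₂ (proj₂ (pair i)))) (toℕ<n _)
      code : Fin k → Fin (t C 2)
      code i = fromℕ< (code< i)

    -- Two different shared colours, put in increasing order, would form a `SharedPair`. This
    -- supplies the last hypothesis of `Block`.
    share : ∀ {i} → ¬ ∃₂ (SharedPair i) → ∀ {r s y y′ z z′} →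
            r ≢ z → r ≢ z′ → y ≢ s → y′ ≢ s →
            colour i y s ≡ colour i r z → colour i y′ s ≡ colour i r z′ →
            colour i r z ≡ colour i r z′
    share {i} none {r} {s} {y} {y′} {z} {z′} rz rz′ ys y′s e e′
      with Fin.<-cmp (colour i r z) (colour i r z′)
    ... | tri≈ _ eq _ = eq
    ... | tri< lt _ _ = contradiction (_ , _ , lt ,
            (r , (z , rz , refl) , (z′ , rz′ , refl)) , (s , (y , ys , e) , (y′ , y′s , e′))) none
    ... | tri> _ _ gt = contradiction (_ , _ , gt ,
            (r , (z′ , rz′ , refl) , (z , rz , refl)) , (s , (y′ , y′s , e′) , (y , ys , e))) none

    hasSharedPair : ∀ d → t ≤ 2 + d → blockSize d ≤ m → ∀ i → ∃₂ (SharedPair i)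
    hasSharedPair d t≤ big i with sharedPair? i
    ... | yes p   = p
    ... | no none = contradiction
      (subst (blockSize d ≤_) (sym (length-tabulate {n = m} _)) big)
      (Block.tooLarge Fin._≟_ Fin._≟_ (colour i) (colour-antisym i) (share none) d
        (Unique.allFin⁺ m) (λ _ _ _ → ∈-allFin _)
        (subst (_≤ 2 + d) (sym (length-tabulate {n = t} _)) t≤))

-- Small cases and the final contradiction

Fin≤1-unique : ∀ {t} → t ≤ 1 → (p q : Fin t) → p ≡ q
Fin≤1-unique (s≤s z≤n) Fin.zero Fin.zero = refl

-- Allowing every `t ≤ c` lets the minimum itself be taken for `t`, without padding the family by
-- empty digraphs.
notPartitionable : ∀ c {k m t} .{{_ : NonZero c}} → k ≥ 1 + c C 2 → 2 * m ≥ 3 * c ! → t ≤ c →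
                   ¬ FerrersPartitionable (complement (M k m)) t
-- Since `3 * c !` is at least 3, the sides 0 and 1 are impossible.
notPartitionable c {suc k} {0} kb mb t≤ (F , part) =
  contradiction (ℕ.≤-trans (ℕ.*-monoʳ-≤ 3 (ℕ.1≤n! c)) mb) λ ()
notPartitionable c {suc k} {1} kb mb t≤ (F , part) =
  contradiction (ℕ.≤-trans (ℕ.*-monoʳ-≤ 3 (ℕ.1≤n! c)) mb) λ { (s≤s (s≤s ())) }
notPartitionable c {suc k} {m@(suc (suc _))} {t} kb mb t≤ (F , part) = cases c kb mb t≤
  where
  open IsFerrersPartition part
  zeroBlock : Fin (suc k)
  zeroBlock = Fin.zero
  default : Fin t
  -- An off-diagonal cell of the first block lies in the complement, so the partition has a member.
  default = proj₁ (Equivalence.to (union (vertex (suc k) m zeroBlock Fin.zero)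
                                    (vertex (suc k) m zeroBlock (Fin.suc Fin.zero)))
    (∁M-edge (suc k) m zeroBlock zeroBlock Fin.zero (Fin.suc Fin.zero)
      (M-entry-diagonal (suc k) m zeroBlock Fin.zero (Fin.suc Fin.zero))))
  open Colouring (suc k) m part default
  cases : ∀ c .{{_ : NonZero c}} → suc k ≥ 1 + c C 2 → 2 * m ≥ 3 * c ! → t ≤ c → ⊥
  -- `blockSize` starts at two colours; for one colour, two mirrored cells already conflict.
  cases 1 _ _ t≤ = colour-antisym zeroBlock {Fin.zero} {Fin.suc Fin.zero} (λ ()) (Fin≤1-unique t≤ _ _)
  cases (suc (suc d)) kb mb t≤ = ℕ.<⇒≱
    (ℕ.<-≤-trans kb (sharedPair-bound (hasSharedPair d t≤
      (ℕ.*-cancelˡ-≤ 2 (subst (_≤ 2 * m) (sym (2*blockSize d)) mb)))))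
    (C2-mono t≤)

theorem6 : (c k m : ℕ) .{{_ : NonZero c}} .{{_ : NonZero k}} .{{_ : NonZero m}} →
    k ≥ 1 + c C 2 → 2 * m ≥ 3 * c ! → f* (M k m) > c
theorem6 c k m kb mb = ℕ.≰⇒> λ f*≤c →
  notPartitionable c kb mb f*≤c (proj₁ (f*-isMinimum (M k m)))
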